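{- Let $\mathbf{k}=(k_1,\dots,k_m)$ be an index. Then $$\sum_{i=0}^{\infty}\zeta_{\widehat{\mathcal{A}}}^{\star}(\{1\}^i,\mathbf{k})\,\boldsymbol{p}^i=-\sum_{i=0}^{\infty}\zeta_{\widehat{\mathcal{A}}}^{\star}(\{1\}^i,\mathbf{k}^{\vee})\,\boldsymbol{p}^i$$ in the ring $\widehat{\mathcal{A}}$.
   Context: An index is a tuple $\mathbf{k}=(k_1,\dots,k_m)$ of positive integers ($m\ge 1$). $(\{1\}^i,\mathbf{k})$ denotes $(\underbrace{1,\dots,1}_{i},k_1,\dots,k_m)$. Hoffman dual: let $W$ be the free monoid on $\{0,1\}$. To an index $\mathbf{k}$ associate the word $w(\mathbf{k})=\underbrace{0\cdots0}_{k_1-1}1\underbrace{0\cdots0}_{k_2-1}1\cdots1\underbrace{0\cdots0}_{k_m-1}1$; $w$ is a bijection from the set of all indices onto $W1$ (words ending in $1$). Let $\tau\colon W\to W$ be the monoid homomorphism with $\tau(0)=1$, $\tau(1)=0$. The Hoffman dual $\mathbf{k}^{\vee}$ is the index determined by $w(\mathbf{k}^{\vee})=\tau(w(\mathbf{k})1^{ -1})1$ (delete the last letter $1$, exchange $0$ and $1$, append $1$). Rings: for each positive integer $n$, $\mathcal{A}_n=\left(\prod_p\mathbb{Z}/p^n\mathbb{Z}\right)/\left(\bigoplus_p\mathbb{Z}/p^n\mathbb{Z}\right)$, where $p$ runs over all prime numbers, and $\widehat{\mathcal{A}}=\varprojlim_n\mathcal{A}_n$, where the $\mathcal{A}_n$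 are discrete and $\widehat{\mathcal{A}}$ has the projective limit topology. There is a natural surjection $\pi\colon\prod_p\mathbb{Z}_p\to\widehat{\mathcal{A}}$ ($\mathbb{Z}_p$ the $p$-adic integers), induced by reduction mod $p^n$ in each component; since components at finitely many primes do not matter, $\pi$ may be applied to families defined for all but finitely many $p$. Put $\boldsymbol{p}=\pi((p)_p)$. The topology of $\widehat{\mathcal{A}}$ is the $\boldsymbol{p}$-adic topology, it is complete, and infinite sums are taken in this topology. Finite multiple zeta-star values: $\zeta_n^{\star}(\mathbf{k})=\sum_{n\ge n_1\ge\cdots\ge n_m\ge1}\frac{1}{n_1^{k_1}\cdots n_m^{k_m}}$ and $\zeta_{\widehat{\mathcal{A}}}^{\star}(\mathbf{k})=\pi\left((\zeta_{p-1}^{\star}(\mathbf{k}))_p\right)\in\widehat{\mathcal{A}}$. -}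

module Defs where

open import Algebra.Bundles using (CommutativeRing)
open import Algebra.Morphism.Structures using (module RingMorphisms)
import Algebra.Definitions.RawMonoid as RawMonoidSum
open import Data.Empty using (⊥-elim)
open import Data.Fin.Base using (Fin; toℕ)
open import Data.Fin.Patterns using (0F; 1F)
open import Data.Fin.Properties using (toℕ<n)
open import Data.Integer.Base as ℤ using (ℤ; +_)
import Data.Integer.Divisibility.Signed as ℤ∣
open import Data.Integer.Divisibility.Signed using (divides)
import Data.Integer.Properties as ℤₚ
open import Data.Integer.Tactic.RingSolver using (solve-∀)
open import Data.List.Base as List using (List; []; _∷_; _++_)
open import Data.List.NonEmpty.Base using (List⁺; _∷_; toList; _++⁺_)
open import Data.Nat.Base as ℕ
  using (ℕ; zero; suc; pred; NonZero; _≤_; _<_; _⊔_; _^_)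
open import Data.Nat.Coprimality as Coprime using (Coprime)
open import Data.Nat.Divisibility as ℕ∣ using (_∣_; _∤_)
open import Data.Nat.GCD using (module Bézout)
open import Data.Nat.Primality
  using (Prime; euclidsLemma; prime⇒irreducible; prime⇒nonZero; prime⇒nonTrivial)
import Data.Nat.Properties as ℕₚ
open import Data.Product.Base using (∃; _,_; proj₁; proj₂)
open import Data.Rational.Base as ℚ using (ℚ; ↥_; ↧_; ↧ₙ_; 1ℚ; _/_)
import Data.Rational.Properties as ℚₚ
open import Data.Sum.Base using (inj₁; inj₂)
open import Function.Base using (_∘_; id)
open import Level using (0ℓ)
open import Relation.Binary.PropositionalEquality
  using (_≡_; refl; sym; trans; cong; subst)

record ℕ⁺ : Set where
  constructor mkℕ⁺
  field
    value       : ℕ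
    .{{nonZero}} : NonZero value

open ℕ⁺ public using (value)

1⁺ : ℕ⁺
1⁺ = mkℕ⁺ 1

suc⁺ : ℕ⁺ → ℕ⁺
suc⁺ k = mkℕ⁺ (suc (value k))

Index : Set
Index = List⁺ ℕ⁺

prependOnes : ℕ → Index → Index
prependOnes i k = List.replicate i 1⁺ ++⁺ k

Word : Set
Word = List (Fin 2)

block : ℕ⁺ → Word
block k = List.replicate (pred (value k)) 0F ++ 1F ∷ []

word : Index → Word
word k = List.concatMap block (toList k)

τ : Word → Word
τ = List.map λ { 0F → 1F ; 1F → 0F }

dropLast : Word → Word
dropLast []           = []
dropLast (a ∷ [])     = []
dropLast (a ∷ b ∷ u) = a ∷ dropLast (b ∷ u)

-- The inverse of k ↦ w(k)1⁻¹; see word-unword and unword-word.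
unword : Word → Index
unword []       = 1⁺ ∷ []
unword (0F ∷ u) with unword u
... | k ∷ ks = suc⁺ k ∷ ks
unword (1F ∷ u) with unword u
... | k ∷ ks = 1⁺ ∷ k ∷ ks

_∨ : Index → Index
k ∨ = unword (τ (dropLast (word k)))

word-unword : ∀ u → word (unword u) ≡ u ++ 1F ∷ []
word-unword []       = refl
word-unword (0F ∷ u) with unword u | word-unword u
... | mkℕ⁺ (suc k) ∷ ks | eq = cong (0F ∷_) eq
word-unword (1F ∷ u) with unword u | word-unword u
... | k ∷ ks | eq = cong (1F ∷_) eq

∨-spec : ∀ k → word (k ∨) ≡ τ (dropLast (word k)) ++ 1F ∷ []
∨-spec k = word-unword (τ (dropLast (word k)))

unword-word : ∀ k → unword (dropLast (word k)) ≡ k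
unword-word (mkℕ⁺ (suc k) ∷ ks) = go k ks
  where
  go : ∀ k ks → unword (dropLast (word (mkℕ⁺ (suc k) ∷ ks))) ≡ mkℕ⁺ (suc k) ∷ ks
  go zero []                              = refl
  go zero (mkℕ⁺ 1 ∷ ks)                   rewrite go zero ks = refl
  go zero (mkℕ⁺ (suc (suc j)) ∷ ks)       rewrite go (suc j) ks = refl
  go 1 ks                                 rewrite go zero ks = refl
  go (suc (suc k)) ks                     rewrite go (suc k) ks = refl

sumℚ : ∀ {n} → (Fin n → ℚ) → ℚ
sumℚ = RawMonoidSum.sum ℚ.+-0-rawMonoid

1/[1+_]^_ : ℕ → ℕ → ℚ
1/[1+ j ]^ k = _/_ (+ 1) (suc j ^ k) {{ℕₚ.m^n≢0 (suc j) k}}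

-- The outermost variable is n₁ = 1 + j with 0 ≤ j < n; the remaining ones
-- satisfy n₁ ≥ n₂ ≥ ⋯ ≥ n_m ≥ 1.
ζ⋆List : ℕ → List ℕ⁺ → ℚ
ζ⋆List n []       = 1ℚ
ζ⋆List n (k ∷ ks) =
  sumℚ {n} λ j → 1/[1+ toℕ j ]^ value k ℚ.* ζ⋆List (suc (toℕ j)) ks

ζ⋆ : ℕ → Index → ℚ
ζ⋆ n k = ζ⋆List n (toList k)

Hom : CommutativeRing 0ℓ 0ℓ → CommutativeRing 0ℓ 0ℓ → Set
Hom R S = ∃ λ f → IsRingHomomorphism f
  where open RingMorphisms (CommutativeRing.rawRing R) (CommutativeRing.rawRing S)

module _ (R S : CommutativeRing 0ℓ 0ℓ) where
  private
    module R = CommutativeRing R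
    module S = CommutativeRing S

  mkHom : (f : R.Carrier → S.Carrier) →
          (∀ {x y} → x R.≈ y → f x S.≈ f y) →
          (∀ x y → f (x R.+ y) S.≈ f x S.+ f y) →
          (∀ x y → f (x R.* y) S.≈ f x S.* f y) →
          (∀ x → f (R.- x) S.≈ S.- f x) →
          f R.0# S.≈ S.0# → f R.1# S.≈ S.1# → Hom R S
  mkHom f f-cong f-+ f-* f-neg f-0 f-1 = f , record
    { isSemiringHomomorphism = record
      { isNearSemiringHomomorphism = record
        { +-isMonoidHomomorphism = record
          { isMagmaHomomorphism = record
            { isRelHomomorphism = record { cong = f-cong }
            ; homo = f-+
            }
          ; ε-homo = f-0
          }
        ; *-homo = f-*
        }
      ; 1#-homo = f-1
      }
    ; -‿homo = f-neg
    }

  module HomLaws (h : Hom R S) where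
    open RingMorphisms.IsRingHomomorphism (proj₂ h) public

infix 4 _≡_[mod_]

record _≡_[mod_] (x y : ℤ) (m : ℕ) : Set where
  constructor mkMod
  field
    m∣x-y : + m ℤ∣.∣ x ℤ.- y

open _≡_[mod_] public

module _ {m : ℕ} where

  ≡⇒mod : ∀ {x y} → x ≡ y → x ≡ y [mod m ]
  ≡⇒mod {x} refl = mkMod (divides (+ 0) (ℤₚ.+-inverseʳ x))

  private
    by : ∀ {x y z} → x ℤ.- y ≡ z → + m ℤ∣.∣ z → x ≡ y [mod m ]
    by eq d = mkMod (subst (+ m ℤ∣.∣_) (sym eq) d)

  mod-sym : ∀ {x y} → x ≡ y [mod m ] → y ≡ x [mod m ]
  mod-sym {x} {y} (mkMod d) = by (lemma x y) (ℤ∣.∣m⇒∣-m d)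
    where
    lemma : ∀ x y → y ℤ.- x ≡ ℤ.- (x ℤ.- y)
    lemma = solve-∀

  mod-trans : ∀ {x y z} → x ≡ y [mod m ] → y ≡ z [mod m ] → x ≡ z [mod m ]
  mod-trans {x} {y} {z} (mkMod d) (mkMod e) = by (lemma x y z) (ℤ∣.∣m∣n⇒∣m+n d e)
    where
    lemma : ∀ x y z → x ℤ.- z ≡ (x ℤ.- y) ℤ.+ (y ℤ.- z)
    lemma = solve-∀

  mod-+ : ∀ {x y u v} → x ≡ y [mod m ] → u ≡ v [mod m ] → x ℤ.+ u ≡ y ℤ.+ v [mod m ]
  mod-+ {x} {y} {u} {v} (mkMod d) (mkMod e) = by (lemma x y u v) (ℤ∣.∣m∣n⇒∣m+n d e)
    where
    lemma : ∀ x y u v → (x ℤ.+ u) ℤ.- (y ℤ.+ v) ≡ (x ℤ.- y) ℤ.+ (u ℤ.- v)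
    lemma = solve-∀

  mod-* : ∀ {x y u v} → x ≡ y [mod m ] → u ≡ v [mod m ] → x ℤ.* u ≡ y ℤ.* v [mod m ]
  mod-* {x} {y} {u} {v} (mkMod d) (mkMod e) =
    by (lemma x y u v) (ℤ∣.∣m∣n⇒∣m+n (ℤ∣.∣m⇒∣m*n u d) (ℤ∣.∣n⇒∣m*n y e))
    where
    lemma : ∀ x y u v →
            x ℤ.* u ℤ.- y ℤ.* v ≡ (x ℤ.- y) ℤ.* u ℤ.+ y ℤ.* (u ℤ.- v)
    lemma = solve-∀

  mod-neg : ∀ {x y} → x ≡ y [mod m ] → ℤ.- x ≡ ℤ.- y [mod m ]
  mod-neg {x} {y} (mkMod d) = by (lemma x y) (ℤ∣.∣m⇒∣-m d)
    where
    lemma : ∀ x y → ℤ.- x ℤ.- ℤ.- y ≡ ℤ.- (x ℤ.- y)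
    lemma = solve-∀

mod-∣ : ∀ {m n x y} → m ∣ n → x ≡ y [mod n ] → x ≡ y [mod m ]
mod-∣ m∣n (mkMod d) = mkMod (ℤ∣.∣-trans (ℤ∣.∣ᵤ⇒∣ m∣n) d)

ℤ/ : ℕ → CommutativeRing 0ℓ 0ℓ
ℤ/ m = record
  { Carrier = ℤ
  ; _≈_ = λ x y → x ≡ y [mod m ]
  ; _+_ = ℤ._+_ ; _*_ = ℤ._*_ ; -_ = ℤ.-_ ; 0# = + 0 ; 1# = + 1
  ; isCommutativeRing = record
    { isRing = record
      { +-isAbelianGroup = record
        { isGroup = record
          { isMonoid = record
            { isSemigroup = record
              { isMagma = record
                { isEquivalence = record
                  { refl = ≡⇒mod refl ; sym = mod-sym ; trans = mod-trans }
                ; ∙-cong = mod-+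
                }
              ; assoc = λ x y z → ≡⇒mod (ℤₚ.+-assoc x y z)
              }
            ; identity = (λ x → ≡⇒mod (ℤₚ.+-identityˡ x))
                       , (λ x → ≡⇒mod (ℤₚ.+-identityʳ x))
            }
          ; inverse = (λ x → ≡⇒mod (ℤₚ.+-inverseˡ x))
                    , (λ x → ≡⇒mod (ℤₚ.+-inverseʳ x))
          ; ⁻¹-cong = mod-neg
          }
        ; comm = λ x y → ≡⇒mod (ℤₚ.+-comm x y)
        }
      ; *-cong = mod-*
      ; *-assoc = λ x y z → ≡⇒mod (ℤₚ.*-assoc x y z)
      ; *-identity = (λ x → ≡⇒mod (ℤₚ.*-identityˡ x))
                   , (λ x → ≡⇒mod (ℤₚ.*-identityʳ x))
      ; distrib = (λ x y z → ≡⇒mod (ℤₚ.*-distribˡ-+ x y z))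
                , (λ x y z → ≡⇒mod (ℤₚ.*-distribʳ-+ x y z))
      }
    ; *-comm = λ x y → ≡⇒mod (ℤₚ.*-comm x y)
    }
  }

ℤ/-reduce : ∀ {m n} → m ∣ n → Hom (ℤ/ n) (ℤ/ m)
ℤ/-reduce {m} {n} m∣n = mkHom (ℤ/ n) (ℤ/ m) id (mod-∣ m∣n)
  (λ _ _ → ≡⇒mod refl) (λ _ _ → ≡⇒mod refl) (λ _ → ≡⇒mod refl)
  (≡⇒mod refl) (≡⇒mod refl)

ℙ : Set
ℙ = ∃ Prime

-- (∏ₚ Rₚ)/(⊕ₚ Rₚ): two families are identified when they differ at only
-- finitely many primes, i.e. agree at all primes from some bound on.
module _ (R : ℙ → CommutativeRing 0ℓ 0ℓ) where
  private module R p = CommutativeRing (R p)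

  record EventuallyEqual (x y : ∀ p → R.Carrier p) : Set where
    constructor mkEE
    field
      bound : ℕ
      holds : ∀ p → bound ≤ proj₁ p → R._≈_ p (x p) (y p)

  open EventuallyEqual

  private
    always : ∀ {x y} → (∀ p → R._≈_ p (x p) (y p)) → EventuallyEqual x y
    always h = mkEE 0 λ p _ → h p

    map₂ : ∀ {x y u v s t} →
           (∀ p → R._≈_ p (x p) (y p) → R._≈_ p (u p) (v p) → R._≈_ p (s p) (t p)) →
           EventuallyEqual x y → EventuallyEqual u v → EventuallyEqual s t
    map₂ h (mkEE M a) (mkEE N b) = mkEE (M ⊔ N) λ p le →
      h p (a p (ℕₚ.m⊔n≤o⇒m≤o M N le)) (b p (ℕₚ.m⊔n≤o⇒n≤o M N le))

  ∏/⊕ : CommutativeRing 0ℓ 0ℓ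
  ∏/⊕ = record
    { Carrier = ∀ p → R.Carrier p
    ; _≈_ = EventuallyEqual
    ; _+_ = λ x y p → R._+_ p (x p) (y p)
    ; _*_ = λ x y p → R._*_ p (x p) (y p)
    ; -_ = λ x p → R.-_ p (x p)
    ; 0# = λ p → R.0# p
    ; 1# = λ p → R.1# p
    ; isCommutativeRing = record
      { isRing = record
        { +-isAbelianGroup = record
          { isGroup = record
            { isMonoid = record
              { isSemigroup = record
                { isMagma = record
                  { isEquivalence = record
                    { refl = always λ p → R.refl p
                    ; sym = λ e → mkEE (bound e) λ p le → R.sym p (holds e p le)
                    ; trans = map₂ λ p → R.trans p
                    }
                  ; ∙-cong = map₂ λ p → R.+-cong p
                  }
                ; assoc = λ x y z → always λ p → R.+-assoc p (x p) (y p) (z p)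
                }
              ; identity = (λ x → always λ p → R.+-identityˡ p (x p))
                         , (λ x → always λ p → R.+-identityʳ p (x p))
              }
            ; inverse = (λ x → always λ p → R.-‿inverseˡ p (x p))
                      , (λ x → always λ p → R.-‿inverseʳ p (x p))
            ; ⁻¹-cong = λ e → mkEE (bound e) λ p le → R.-‿cong p (holds e p le)
            }
          ; comm = λ x y → always λ p → R.+-comm p (x p) (y p)
          }
        ; *-cong = map₂ λ p → R.*-cong p
        ; *-assoc = λ x y z → always λ p → R.*-assoc p (x p) (y p) (z p)
        ; *-identity = (λ x → always λ p → R.*-identityˡ p (x p))
                     , (λ x → always λ p → R.*-identityʳ p (x p))
        ; distrib = (λ x y z → always λ p → R.distribˡ p (x p) (y p) (z p))
                  , (λ x y z → always λ p → R.distribʳ p (x p) (y p) (z p))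
        }
      ; *-comm = λ x y → always λ p → R.*-comm p (x p) (y p)
      }
    }

∏/⊕-map : ∀ {R S : ℙ → CommutativeRing 0ℓ 0ℓ} →
          (∀ p → Hom (R p) (S p)) → Hom (∏/⊕ R) (∏/⊕ S)
∏/⊕-map {R} {S} h = mkHom (∏/⊕ R) (∏/⊕ S) (λ x p → proj₁ (h p) (x p))
  (λ e → mkEE (EventuallyEqual.bound e) λ p le →
    L.⟦⟧-cong p (EventuallyEqual.holds e p le))
  (λ x y → mkEE 0 λ p _ → L.+-homo p (x p) (y p))
  (λ x y → mkEE 0 λ p _ → L.*-homo p (x p) (y p))
  (λ x → mkEE 0 λ p _ → L.-‿homo p (x p))
  (mkEE 0 λ p _ → L.0#-homo p)
  (mkEE 0 λ p _ → L.1#-homo p)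
  where module L p = HomLaws (R p) (S p) (h p)

module _ (R : ℕ → CommutativeRing 0ℓ 0ℓ) (φ : ∀ n → Hom (R (suc n)) (R n)) where
  private
    module R n = CommutativeRing (R n)
    module L n = HomLaws (R (suc n)) (R n) (φ n)

  record Coherent : Set where
    constructor mkCoherent
    field
      at       : ∀ n → R.Carrier n
      coherent : ∀ n → R._≈_ n (proj₁ (φ n) (at (suc n))) (at n)

  open Coherent

  record LevelwiseEqual (x y : Coherent) : Set where
    constructor mkLE
    field
      level : ∀ n → R._≈_ n (at x n) (at y n)

  open LevelwiseEqual

  lim : CommutativeRing 0ℓ 0ℓ
  lim = record
    { Carrier = Coherent
    ; _≈_ = LevelwiseEqual
    ; _+_ = λ x y → mkCoherent (λ n → R._+_ n (at x n) (at y n)) λ n →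
        R.trans n (L.+-homo n _ _) (R.+-cong n (coherent x n) (coherent y n))
    ; _*_ = λ x y → mkCoherent (λ n → R._*_ n (at x n) (at y n)) λ n →
        R.trans n (L.*-homo n _ _) (R.*-cong n (coherent x n) (coherent y n))
    ; -_ = λ x → mkCoherent (λ n → R.-_ n (at x n)) λ n →
        R.trans n (L.-‿homo n _) (R.-‿cong n (coherent x n))
    ; 0# = mkCoherent R.0# L.0#-homo
    ; 1# = mkCoherent R.1# L.1#-homo
    ; isCommutativeRing = record
      { isRing = record
        { +-isAbelianGroup = record
          { isGroup = record
            { isMonoid = record
              { isSemigroup = record
                { isMagma = record
                  { isEquivalence = record
                    { refl = mkLE λ n → R.refl n
                    ; sym = λ e → mkLE λ n → R.sym n (level e n)
                    ; trans = λ e f → mkLE λ n → R.trans n (level e n) (level f n)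
                    }
                  ; ∙-cong = λ e f → mkLE λ n → R.+-cong n (level e n) (level f n)
                  }
                ; assoc = λ x y z → mkLE λ n → R.+-assoc n (at x n) (at y n) (at z n)
                }
              ; identity = (λ x → mkLE λ n → R.+-identityˡ n (at x n))
                         , (λ x → mkLE λ n → R.+-identityʳ n (at x n))
              }
            ; inverse = (λ x → mkLE λ n → R.-‿inverseˡ n (at x n))
                      , (λ x → mkLE λ n → R.-‿inverseʳ n (at x n))
            ; ⁻¹-cong = λ e → mkLE λ n → R.-‿cong n (level e n)
            }
          ; comm = λ x y → mkLE λ n → R.+-comm n (at x n) (at y n)
          }
        ; *-cong = λ e f → mkLE λ n → R.*-cong n (level e n) (level f n)
        ; *-assoc = λ x y z → mkLE λ n → R.*-assoc n (at x n) (at y n) (at z n)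
        ; *-identity = (λ x → mkLE λ n → R.*-identityˡ n (at x n))
                     , (λ x → mkLE λ n → R.*-identityʳ n (at x n))
        ; distrib = (λ x y z → mkLE λ n → R.distribˡ n (at x n) (at y n) (at z n))
                  , (λ x y z → mkLE λ n → R.distribʳ n (at x n) (at y n) (at z n))
        }
      ; *-comm = λ x y → mkLE λ n → R.*-comm n (at x n) (at y n)
      }
    }

open EventuallyEqual public
open Coherent public
open LevelwiseEqual public

p^n∣p^[1+n] : ∀ p n → p ^ n ∣ p ^ suc n
p^n∣p^[1+n] p n = ℕ∣.n∣m*n p

-- The limit is taken over n ≥ 0; the extra term ℤ/p⁰ is the zero ring and
-- does not change it. The same applies to Â below.
ℤ[_] : ℙ → CommutativeRing 0ℓ 0ℓ
ℤ[ p ] = lim (λ n → ℤ/ (proj₁ p ^ n)) (λ n → ℤ/-reduce (p^n∣p^[1+n] (proj₁ p) n))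

𝒜 : ℕ → CommutativeRing 0ℓ 0ℓ
𝒜 n = ∏/⊕ (λ p → ℤ/ (proj₁ p ^ n))

Â : CommutativeRing 0ℓ 0ℓ
Â = lim 𝒜 (λ n → ∏/⊕-map (λ p → ℤ/-reduce (p^n∣p^[1+n] (proj₁ p) n)))

module ℤ[] p = CommutativeRing ℤ[ p ]
module 𝒜 n = CommutativeRing (𝒜 n)
module Â = CommutativeRing Â

π : (∀ p → ℤ[].Carrier p) → Â.Carrier
π x = mkCoherent (λ n p → at (x p) n) (λ n → mkEE 0 λ p _ → coherent (x p) n)

fromℤ : ∀ p → ℤ → ℤ[].Carrier p
fromℤ p z = mkCoherent (λ _ → z) (λ _ → ≡⇒mod refl)

𝒑 : Â.Carrier
𝒑 = π λ p → fromℤ p (+ proj₁ p)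

open import Algebra.Properties.Semiring.Exp Â.semiring public
  using () renaming (_^_ to _^Â_)

coprime-* : ∀ {b m n} → Coprime b m → Coprime b n → Coprime b (m ℕ.* n)
coprime-* c c′ (d∣b , d∣mn) =
  c′ (d∣b , Coprime.coprime-divisor (λ (e∣d , e∣m) → c (ℕ∣.∣-trans e∣d d∣b , e∣m)) d∣mn)

coprime-^ : ∀ (p : ℙ) {b} → proj₁ p ∤ b → ∀ n → Coprime b (proj₁ p ^ n)
coprime-^ p       p∤b zero    (_ , d∣1) = ℕ∣.∣1⇒≡1 d∣1
coprime-^ (p , P) {b} p∤b (suc n) = coprime-* base (coprime-^ (p , P) p∤b n)
  where
  base : Coprime b p
  base (d∣b , d∣p) with prime⇒irreducible P d∣p
  ... | inj₁ d≡1  = d≡1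
  ... | inj₂ refl = ⊥-elim (p∤b d∣b)

inverse : ∀ {b m} → Coprime b m → ∃ λ x → + b ℤ.* x ≡ + 1 [mod m ]
inverse {b} {m} c with Coprime.coprime-Bézout c
... | Bézout.+- x y eq = + x , mkMod (divides (+ y) (lemma (+ x) (+ y) (+ b) (+ m)
        (trans (cong (λ t → + 1 ℤ.+ t) (sym (ℤₚ.pos-* y m)))
          (trans (cong +_ eq) (ℤₚ.pos-* x b)))))
  where
  alg : ∀ x y b m → b ℤ.* x ℤ.- + 1 ≡ x ℤ.* b ℤ.- (+ 1 ℤ.+ y ℤ.* m) ℤ.+ y ℤ.* m
  alg = solve-∀
  lemma : ∀ x y b m → + 1 ℤ.+ y ℤ.* m ≡ x ℤ.* b → b ℤ.* x ℤ.- + 1 ≡ y ℤ.* m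
  lemma x y b m e = trans (alg x y b m)
    (trans (cong (λ t → x ℤ.* b ℤ.- t ℤ.+ y ℤ.* m) e)
      (trans (cong (ℤ._+ y ℤ.* m) (ℤₚ.+-inverseʳ (x ℤ.* b))) (ℤₚ.+-identityˡ _)))
... | Bézout.-+ x y eq = ℤ.- + x , mkMod (divides (ℤ.- + y) (lemma (+ x) (+ y) (+ b) (+ m)
        (trans (cong (λ t → + 1 ℤ.+ t) (sym (ℤₚ.pos-* x b)))
          (trans (cong +_ eq) (ℤₚ.pos-* y m)))))
  where
  alg : ∀ x b → b ℤ.* ℤ.- x ℤ.- + 1 ≡ ℤ.- (+ 1 ℤ.+ x ℤ.* b)
  alg = solve-∀
  lemma : ∀ x y b m → + 1 ℤ.+ x ℤ.* b ≡ y ℤ.* m →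
          b ℤ.* ℤ.- x ℤ.- + 1 ≡ ℤ.- y ℤ.* m
  lemma x y b m e = trans (alg x b)
    (trans (cong ℤ.-_ e) (ℤₚ.neg-distribˡ-* y m))

inverse-unique : ∀ {b x y m} → b ℤ.* x ≡ + 1 [mod m ] → b ℤ.* y ≡ + 1 [mod m ] →
                 x ≡ y [mod m ]
inverse-unique {b} {x} {y} bx by =
  mod-trans (≡⇒mod (sym (ℤₚ.*-identityʳ x)))
  (mod-trans (mod-* (≡⇒mod {x = x} refl) (mod-sym by))
  (mod-trans (≡⇒mod (lemma x b y))
  (mod-trans (mod-* (≡⇒mod {x = y} refl) bx)
  (≡⇒mod (ℤₚ.*-identityʳ y)))))
  where
  lemma : ∀ x b y → x ℤ.* (b ℤ.* y) ≡ y ℤ.* (b ℤ.* x)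
  lemma = solve-∀

-- ℚ is normalised, so this says that q lies in ℚ ∩ ℤ_p.
Integral : ℙ → ℚ → Set
Integral p q = proj₁ p ∤ ↧ₙ q

fromℚ : ∀ p q → Integral p q → ℤ[].Carrier p
fromℚ p q p∤ = mkCoherent (λ n → ↥ q ℤ.* proj₁ (inv n)) λ n →
  mod-* (≡⇒mod {x = ↥ q} refl)
    (inverse-unique {b = ↧ q} (mod-∣ (p^n∣p^[1+n] (proj₁ p) n) (proj₂ (inv (suc n))))
      (proj₂ (inv n)))
  where
  inv : ∀ n → ∃ λ x → ↧ q ℤ.* x ≡ + 1 [mod proj₁ p ^ n ]
  inv n = inverse (coprime-^ p p∤ n)

module _ (p : ℙ) where
  private
    ∤-* : ∀ {m n} → proj₁ p ∤ m → proj₁ p ∤ n → proj₁ p ∤ m ℕ.* n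
    ∤-* {m} {n} a b d with euclidsLemma m n (proj₂ p) d
    ... | inj₁ e = a e
    ... | inj₂ e = b e

    ∤-1 : proj₁ p ∤ 1
    ∤-1 d = ℕ.nonTrivial⇒≢1 {{prime⇒nonTrivial (proj₂ p)}} (ℕ∣.∣1⇒≡1 d)

    ↧-∣ : ∀ {q : ℚ} {z d} → ↧ q ℤ.* z ≡ + d → ↧ₙ q ∣ d
    ↧-∣ {q} {z} eq =
      ℕ∣.divides ℤ.∣ z ∣ (trans (cong ℤ.∣_∣ (sym eq))
        (trans (ℤₚ.abs-* (↧ q) z) (ℕₚ.*-comm (↧ₙ q) ℤ.∣ z ∣)))

    ↧ₙ-+ : ∀ q r → ↧ₙ (q ℚ.+ r) ∣ ↧ₙ q ℕ.* ↧ₙ r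
    ↧ₙ-+ q r = ↧-∣ {q ℚ.+ r} (trans (ℚₚ.↧-+ q r) (sym (ℤₚ.pos-* (↧ₙ q) (↧ₙ r))))

    ↧ₙ-* : ∀ q r → ↧ₙ (q ℚ.* r) ∣ ↧ₙ q ℕ.* ↧ₙ r
    ↧ₙ-* q r = ↧-∣ {q ℚ.* r} (trans (ℚₚ.↧-* q r) (sym (ℤₚ.pos-* (↧ₙ q) (↧ₙ r))))

  integral-+ : ∀ q r → Integral p q → Integral p r → Integral p (q ℚ.+ r)
  integral-+ q r a b d = ∤-* {↧ₙ q} {↧ₙ r} a b (ℕ∣.∣-trans d (↧ₙ-+ q r))

  integral-* : ∀ q r → Integral p q → Integral p r → Integral p (q ℚ.* r)
  integral-* q r a b d = ∤-* {↧ₙ q} {↧ₙ r} a b (ℕ∣.∣-trans d (↧ₙ-* q r))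

  integral-sum : ∀ {n} (f : Fin n → ℚ) → (∀ j → Integral p (f j)) → Integral p (sumℚ f)
  integral-sum {zero}  f h = ∤-1
  integral-sum {suc n} f h =
    integral-+ (f 0F) (sumℚ (f ∘ Fin.suc)) (h 0F) (integral-sum (f ∘ Fin.suc) (h ∘ Fin.suc))

  integral-1/ : ∀ j k → suc j < proj₁ p → Integral p (1/[1+ j ]^ k)
  integral-1/ j k j<p d = ∤-^ k (ℕ∣.∣-trans d
    (↧-∣ {1/[1+ j ]^ k} (ℚₚ.↧-/ (+ 1) (suc j ^ k) {{ℕₚ.m^n≢0 (suc j) k}})))
    where
    ∤-^ : ∀ k → proj₁ p ∤ suc j ^ k
    ∤-^ zero    = ∤-1
    ∤-^ (suc k) = ∤-* {suc j} (ℕ∣.>⇒∤ j<p) (∤-^ k)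

  integral-ζ⋆List : ∀ n ks → n < proj₁ p → Integral p (ζ⋆List n ks)
  integral-ζ⋆List n []       n<p = ∤-1
  integral-ζ⋆List n (k ∷ ks) n<p = integral-sum {n} _ λ j →
    let 1+j<p = ℕₚ.≤-<-trans (toℕ<n j) n<p in
    integral-* (1/[1+ toℕ j ]^ value k) (ζ⋆List (suc (toℕ j)) ks)
      (integral-1/ (toℕ j) (value k) 1+j<p) (integral-ζ⋆List (suc (toℕ j)) ks 1+j<p)

  integral-ζ⋆ : ∀ k → Integral p (ζ⋆ (proj₁ p ℕ.∸ 1) k)
  integral-ζ⋆ k = integral-ζ⋆List (proj₁ p ℕ.∸ 1) (toList k) (p∸1<p (proj₁ p) (prime⇒nonZero (proj₂ p)))
    where
    p∸1<p : ∀ q → NonZero q → q ℕ.∸ 1 < q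
    p∸1<p (suc q) _ = ℕₚ.n<1+n q

ζ⋆Â : Index → Â.Carrier
ζ⋆Â k = π λ p → fromℚ p (ζ⋆ (proj₁ p ℕ.∸ 1) k) (integral-ζ⋆ p k)

-- Convergence in the projective limit topology with discrete 𝒜ₙ: at every
-- level n the sequence is eventually constant in 𝒜ₙ.
infix 4 _⟶_
_⟶_ : (ℕ → Â.Carrier) → Â.Carrier → Set
s ⟶ x = ∀ n → ∃ λ M → ∀ m → M ≤ m → 𝒜._≈_ n (at (s m) n) (at x n)

partialSum : (ℕ → Â.Carrier) → ℕ → Â.Carrier
partialSum f m = RawMonoidSum.sum Â.+-rawMonoid {m} λ i → f (toℕ i)

HasSum : (ℕ → Â.Carrier) → Â.Carrier → Set
HasSum f x = partialSum f ⟶ x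

-- Hence HasSum f S determines S: it reads as  ∑_{i≥0} f i = S.
HasSum-unique : ∀ {f x y} → HasSum f x → HasSum f y → x Â.≈ y
HasSum-unique hx hy = mkLE λ n →
  let (M , a) = hx n ; (N , b) = hy n in
  𝒜.trans n (𝒜.sym n (a (M ⊔ N) (ℕₚ.m≤m⊔n M N))) (b (M ⊔ N) (ℕₚ.m≤n⊔m M N))

{-# OPTIONS --safe #-}
module Submission where

-- Let p = q + 1 be an odd prime and let a(n-1) be the summand of ζ⋆(k) with outermost
-- variable n. Summing the geometric series ∑ᵢ ζ⋆_q({1}ⁱ,k) pⁱ turns the weight of a(n-1) into
--   ∏_{m=n}^{q} (1 - p/m)⁻¹ = (-1)ⁿ⁻¹ C(q, n-1),
-- so the sum is the binomial transform of a at q without its last term. By Hoffman's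
-- duality the binomial transform exchanges the summands of k and of k∨, hence the sum
-- equals a_{k∨}(q) - a_k(q), which is antisymmetric in k ↔ k∨.

open import Defs
open import Data.Empty using (⊥-elim)
open import Data.Fin.Base using (toℕ)
open import Data.Fin.Patterns using (0F; 1F)
open import Data.Integer.Base as ℤ using (ℤ)
import Data.Integer.Divisibility.Signed as ℤ∣
import Data.Integer.Properties as ℤₚ
open import Data.Integer.Tactic.RingSolver using () renaming (solve-∀ to ℤ-solve-∀)
open import Data.List.Base using ([]; _∷_)
open import Data.List.NonEmpty.Base using (_∷_)
open import Data.Nat.Base as ℕ using (ℕ; zero; suc; _∸_; _≤_; _<_; s≤s; z≤n; NonZero)
open import Data.Nat.Divisibility as ℕ∣ using (_∣_; _∤_)
open import Data.Nat.Coprimality using (Coprime)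
open import Data.Nat.Primality using (Prime; prime⇒irreducible; prime⇒nonTrivial; prime⇒nonZero)
import Data.Nat.Properties as ℕₚ
open import Data.Product using (∃₂; _×_; _,_; proj₁; proj₂)
open import Data.Rational.Base as ℚ using (ℚ; 0ℚ; 1ℚ; _+_; _*_; _-_; -_; _/_; toℚᵘ)
import Data.Rational.Properties as ℚₚ
open import Data.Rational.Unnormalised.Base using (mkℚᵘ; _≃_; *≡*)
import Data.Rational.Unnormalised.Properties as ℚᵘₚ
open import Data.Sum.Base using (inj₂)
open import Function.Base using (_∘_)
open import Level using (0ℓ)
open import Relation.Binary.PropositionalEquality
  using (_≡_; refl; sym; trans; cong; cong₂; subst; module ≡-Reasoning)
open import Relation.Nullary.Decidable using (dec⇒maybe)
open import Tactic.RingSolver using (solve-∀)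
open import Tactic.RingSolver.Core.AlmostCommutativeRing
  using (AlmostCommutativeRing; fromCommutativeRing)

open ≡-Reasoning

-- Natural numbers and reciprocals in ℚ

ℚ-ring : AlmostCommutativeRing 0ℓ 0ℓ
ℚ-ring = fromCommutativeRing ℚₚ.+-*-commutativeRing λ x → dec⇒maybe (0ℚ ℚₚ.≟ x)

-- Recursive, so that `fromℕ (suc n)` unfolds to `1ℚ + fromℕ n`, the form that the solver identities
-- expect.
fromℕ : ℕ → ℚ
fromℕ zero    = 0ℚ
fromℕ (suc n) = 1ℚ + fromℕ n

recip : ℕ → ℚ
recip j = 1/[1+ j ]^ 1

toℚᵘ-/ : ∀ i n → toℚᵘ (i / suc n) ≃ mkℚᵘ i n
toℚᵘ-/ i n = ℚₚ.toℚᵘ-fromℚᵘ (mkℚᵘ i n)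

/-*-/ : ∀ i m j n .{{_ : NonZero m}} .{{_ : NonZero n}} .{{_ : NonZero (m ℕ.* n)}} →
        (i / m) * (j / n) ≡ (i ℤ.* j) / (m ℕ.* n)
/-*-/ i (suc m) j (suc n) = ℚₚ.toℚᵘ-injective
  (ℚᵘₚ.≃-trans (ℚₚ.toℚᵘ-homo-* (i / suc m) (j / suc n))
  (ℚᵘₚ.≃-trans (ℚᵘₚ.*-cong (toℚᵘ-/ i m) (toℚᵘ-/ j n))
  (ℚᵘₚ.≃-sym (toℚᵘ-/ (i ℤ.* j) _))))

fromℕ≡/1 : ∀ n → fromℕ n ≡ ℤ.+ n / 1
fromℕ≡/1 zero    = refl
fromℕ≡/1 (suc n) = trans (cong (1ℚ +_) (fromℕ≡/1 n)) (ℚₚ.toℚᵘ-injective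
  (ℚᵘₚ.≃-trans (ℚₚ.toℚᵘ-homo-+ 1ℚ (ℤ.+ n / 1))
  (ℚᵘₚ.≃-trans (ℚᵘₚ.+-cong (toℚᵘ-/ (ℤ.+ 1) 0) (toℚᵘ-/ (ℤ.+ n) 0))
  (ℚᵘₚ.≃-trans (*≡* (cong (λ t → (ℤ.+ 1 ℤ.+ t) ℤ.* ℤ.+ 1) (ℤₚ.*-identityʳ (ℤ.+ n))))
  (ℚᵘₚ.≃-sym (toℚᵘ-/ (ℤ.+ suc n) 0))))))

fromℕ*recip : ∀ n → fromℕ (suc n) * recip n ≡ 1ℚ
fromℕ*recip n = begin
  fromℕ (suc n) * recip n                    ≡⟨ cong (_* recip n) (fromℕ≡/1 (suc n)) ⟩
  (ℤ.+ suc n / 1) * recip n                    ≡⟨ ℚₚ.toℚᵘ-injective lemma ⟩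
  1ℚ                                         ∎
  where
  n*1 = n ℕ.* 1
  lemma : toℚᵘ ((ℤ.+ suc n / 1) * recip n) ≃ toℚᵘ 1ℚ
  lemma = ℚᵘₚ.≃-trans (ℚₚ.toℚᵘ-homo-* (ℤ.+ suc n / 1) (recip n))
    (ℚᵘₚ.≃-trans (ℚᵘₚ.*-cong (toℚᵘ-/ (ℤ.+ suc n) 0) (toℚᵘ-/ (ℤ.+ 1) n*1))
      (*≡* (trans (ℤₚ.*-identityʳ _) (trans (ℤₚ.*-identityʳ (ℤ.+ suc n))
        (trans (cong (λ t → ℤ.+ suc t) (sym (trans (ℕₚ.+-identityʳ n*1) (ℕₚ.*-identityʳ n))))
          (sym (ℤₚ.*-identityˡ _)))))))

1/[1+]^-suc : ∀ j k → 1/[1+ j ]^ suc k ≡ recip j * 1/[1+ j ]^ k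
1/[1+]^-suc j k = begin
  1/[1+ j ]^ suc k                                ≡⟨ ℚₚ./-cong {p₁ = ℤ.+ 1} refl (cong (ℕ._* suc j ℕ.^ k) (sym (ℕₚ.*-identityʳ (suc j)))) ⟩
  _/_ (ℤ.+ 1) (suc j ℕ.^ 1 ℕ.* suc j ℕ.^ k)   ≡⟨ /-*-/ (ℤ.+ 1) (suc j ℕ.^ 1) (ℤ.+ 1) (suc j ℕ.^ k) ⟨
  recip j * 1/[1+ j ]^ k                          ∎
  where instance
    _ = ℕₚ.m^n≢0 (suc j) 1
    _ = ℕₚ.m^n≢0 (suc j) k
    _ = ℕₚ.m^n≢0 (suc j) (suc k)
    _ = ℕₚ.m*n≢0 (suc j ℕ.^ 1) (suc j ℕ.^ k)

fromℕ-cancelˡ : ∀ n {x y} → fromℕ (suc n) * x ≡ fromℕ (suc n) * y → x ≡ y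
fromℕ-cancelˡ n {x} {y} eq = begin
  x                                ≡⟨ unfold x ⟩
  recip n * (fromℕ (suc n) * x)    ≡⟨ cong (recip n *_) eq ⟩
  recip n * (fromℕ (suc n) * y)    ≡⟨ unfold y ⟨
  y                                ∎
  where
  assoc : ∀ r m x → m * r * x ≡ r * (m * x)
  assoc = solve-∀ ℚ-ring
  unfold : ∀ x → x ≡ recip n * (fromℕ (suc n) * x)
  unfold x = trans (sym (trans (cong (_* x) (fromℕ*recip n)) (ℚₚ.*-identityˡ x)))
    (assoc (recip n) (fromℕ (suc n)) x)

fromℕ*recip* : ∀ n x → fromℕ (suc n) * (recip n * x) ≡ x
fromℕ*recip* n x = trans (sym (ℚₚ.*-assoc (fromℕ (suc n)) (recip n) x))
  (trans (cong (_* x) (fromℕ*recip n)) (ℚₚ.*-identityˡ x))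

-- Finite sums

Σ< : (ℕ → ℚ) → ℕ → ℚ
Σ< f zero    = 0ℚ
Σ< f (suc n) = Σ< f n + f n

Σ<-cong : ∀ {f g} n → (∀ j → j < n → f j ≡ g j) → Σ< f n ≡ Σ< g n
Σ<-cong zero    eq = refl
Σ<-cong (suc n) eq =
  cong₂ _+_ (Σ<-cong n λ j j<n → eq j (ℕₚ.m<n⇒m<1+n j<n)) (eq n ℕₚ.≤-refl)

Σ<-linear : ∀ f g c n → Σ< (λ j → f j + c * g j) n ≡ Σ< f n + c * Σ< g n
Σ<-linear f g c zero    = zeros c
  where
  zeros : ∀ c → 0ℚ ≡ 0ℚ + c * 0ℚ
  zeros = solve-∀ ℚ-ring
Σ<-linear f g c (suc n) = trans (cong (_+ (f n + c * g n)) (Σ<-linear f g c n))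
  (alg (Σ< f n) (Σ< g n) (f n) (g n) c)
  where
  alg : ∀ a b x y c → a + c * b + (x + c * y) ≡ a + x + c * (b + y)
  alg = solve-∀ ℚ-ring

Σ<-head : ∀ f n → Σ< f (suc n) ≡ f 0 + Σ< (f ∘ suc) n
Σ<-head f zero    = ℚₚ.+-comm 0ℚ (f 0)
Σ<-head f (suc n) = trans (cong (_+ f (suc n)) (Σ<-head f n)) (ℚₚ.+-assoc (f 0) _ _)

-- `sumℚ` peels off the first term; `Σ<` grows at its last term, as inductions on the upper bound
-- require.
sumℚ≡Σ< : ∀ f n → sumℚ {n} (λ j → f (toℕ j)) ≡ Σ< f n
sumℚ≡Σ< f zero    = refl
sumℚ≡Σ< f (suc n) = trans (cong (f 0 +_) (sumℚ≡Σ< (f ∘ suc) n)) (sym (Σ<-head f n))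

-- Difference tables and Hoffman duality


Table : Set
Table = ℕ → ℕ → ℚ

-- Then X 0 is the binomial transform of the sequence i ↦ X i 0, and vice versa.
IsDifferenceTable : Table → Set
IsDifferenceTable X = ∀ i j → X i j ≡ X (suc i) j + X i (suc j)

transpose : Table → Table
transpose X i j = X j i

transpose-isDifferenceTable : ∀ {X} → IsDifferenceTable X → IsDifferenceTable (transpose X)
transpose-isDifferenceTable {X} d i j = trans (d j i) (ℚₚ.+-comm (X (suc j) i) (X j (suc i)))

-- Dividing Y i 0 by i + 1 turns Y 0 j into the average 1/(j+1) ∑_{i≤j} Y 0 i.
scale : Table → Table
scale Y i zero    = recip i * Y i zero
scale Y i (suc j) = recip (suc j ℕ.+ i) * (Y i (suc j) + fromℕ (suc j) * scale Y i j)

scale-zero : ∀ Y i → fromℕ (suc i) * scale Y i 0 ≡ Y i 0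
scale-zero Y i = fromℕ*recip* i (Y i 0)

scale-suc : ∀ Y i j → fromℕ (suc (suc (j ℕ.+ i))) * scale Y i (suc j) ≡
                      Y i (suc j) + fromℕ (suc j) * scale Y i j
scale-suc Y i j = fromℕ*recip* (suc j ℕ.+ i) (Y i (suc j) + fromℕ (suc j) * scale Y i j)

-- Induction on `j`. `X = scale Y` satisfies (i+j+1) X i j = Y i j + j X i (j-1). After multiplying
-- by i+j+2 and splitting off one `X i j`, the rule for `Y` and the induction hypothesis yield these
-- relations for X (i+1) j and X i (j+1).
scale-isDifferenceTable : ∀ {Y} → IsDifferenceTable Y → IsDifferenceTable (scale Y)
scale-isDifferenceTable {Y} d i zero = fromℕ-cancelˡ (suc i) (begin
  fromℕ (2 ℕ.+ i) * X i 0                                     ≡⟨ split (fromℕ i) (X i 0) ⟩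
  fromℕ (suc i) * X i 0 + X i 0                               ≡⟨ cong (_+ X i 0) (trans (scale-zero Y i) (d i 0)) ⟩
  Y (suc i) 0 + Y i 1 + X i 0                                 ≡⟨ regroup (Y (suc i) 0) (Y i 1) (X i 0) ⟩
  Y (suc i) 0 + (Y i 1 + fromℕ 1 * X i 0)                     ≡⟨ cong₂ _+_ (scale-zero Y (suc i)) (scale-suc Y i 0) ⟨
  fromℕ (2 ℕ.+ i) * X (suc i) 0 + fromℕ (2 ℕ.+ i) * X i 1     ≡⟨ ℚₚ.*-distribˡ-+ (fromℕ (2 ℕ.+ i)) _ _ ⟨
  fromℕ (2 ℕ.+ i) * (X (suc i) 0 + X i 1)                     ∎)
  where
  X = scale Y
  split : ∀ n x → (1ℚ + (1ℚ + n)) * x ≡ (1ℚ + n) * x + x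
  split = solve-∀ ℚ-ring
  regroup : ∀ a b x → a + b + x ≡ a + (b + (1ℚ + 0ℚ) * x)
  regroup = solve-∀ ℚ-ring
scale-isDifferenceTable {Y} d i (suc j) = fromℕ-cancelˡ (2 ℕ.+ (j ℕ.+ i)) (begin
  m * X i (suc j)
    ≡⟨ split (fromℕ (j ℕ.+ i)) (X i (suc j)) ⟩
  fromℕ (2 ℕ.+ (j ℕ.+ i)) * X i (suc j) + X i (suc j)
    ≡⟨ cong (_+ X i (suc j)) (trans (scale-suc Y i j)
         (cong₂ (λ y x → y + fromℕ (suc j) * x) (d i (suc j)) (scale-isDifferenceTable d i j))) ⟩
  Y (suc i) (suc j) + Y i (2 ℕ.+ j) + fromℕ (suc j) * (X (suc i) j + X i (suc j)) + X i (suc j)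
    ≡⟨ regroup (Y (suc i) (suc j)) (Y i (2 ℕ.+ j)) (fromℕ (suc j)) (X (suc i) j) (X i (suc j)) ⟩
  (Y (suc i) (suc j) + fromℕ (suc j) * X (suc i) j) + (Y i (2 ℕ.+ j) + fromℕ (2 ℕ.+ j) * X i (suc j))
    ≡⟨ cong₂ _+_ row (scale-suc Y i (suc j)) ⟨
  m * X (suc i) (suc j) + m * X i (2 ℕ.+ j)
    ≡⟨ ℚₚ.*-distribˡ-+ m _ _ ⟨
  m * (X (suc i) (suc j) + X i (2 ℕ.+ j))
    ∎)
  where
  X = scale Y
  m = fromℕ (3 ℕ.+ (j ℕ.+ i))
  row : m * X (suc i) (suc j) ≡ Y (suc i) (suc j) + fromℕ (suc j) * X (suc i) j
  row = subst
    (λ t → fromℕ (2 ℕ.+ t) * X (suc i) (suc j) ≡ Y (suc i) (suc j) + fromℕ (suc j) * X (suc i) j)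
    (ℕₚ.+-suc j i) (scale-suc Y (suc i) j)
  split : ∀ n x → (1ℚ + (1ℚ + (1ℚ + n))) * x ≡ (1ℚ + (1ℚ + n)) * x + x
  split = solve-∀ ℚ-ring
  regroup : ∀ a b n u v → a + b + n * (u + v) + v ≡ (a + n * u) + (b + (1ℚ + n) * v)
  regroup = solve-∀ ℚ-ring

-- At `i = 0` the recurrence says that (j+1) X 0 j grows by Y 0 (j+1) when `j` does, so it
-- telescopes.
scale-column : ∀ Y j → scale Y 0 j ≡ recip j * Σ< (Y 0) (suc j)
scale-column Y j = fromℕ-cancelˡ j (trans (go j) (sym (fromℕ*recip* j _)))
  where
  go : ∀ j → fromℕ (suc j) * scale Y 0 j ≡ Σ< (Y 0) (suc j)
  go zero    = trans (scale-zero Y 0) (sym (ℚₚ.+-identityˡ (Y 0 0)))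
  go (suc j) = begin
    fromℕ (2 ℕ.+ j) * scale Y 0 (suc j)         ≡⟨ cong (λ t → fromℕ (2 ℕ.+ t) * scale Y 0 (suc j)) (ℕₚ.+-identityʳ j) ⟨
    fromℕ (2 ℕ.+ (j ℕ.+ 0)) * scale Y 0 (suc j) ≡⟨ scale-suc Y 0 j ⟩
    Y 0 (suc j) + fromℕ (suc j) * scale Y 0 j   ≡⟨ cong (Y 0 (suc j) +_) (go j) ⟩
    Y 0 (suc j) + Σ< (Y 0) (suc j)              ≡⟨ ℚₚ.+-comm (Y 0 (suc j)) _ ⟩
    Σ< (Y 0) (2 ℕ.+ j)                          ∎

-- The difference table of the constant sequence 1; scaling it gives `recip` along both edges, the
-- summands of the self-dual index (1).
unitColumn : Table
unitColumn i zero    = 1ℚ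
unitColumn i (suc j) = 0ℚ

unitColumn-isDifferenceTable : IsDifferenceTable unitColumn
unitColumn-isDifferenceTable i zero    = refl
unitColumn-isDifferenceTable i (suc j) = refl

-- Prepending `0F` divides the edge `i ↦ X i 0` by i+1 and averages the edge `j ↦ X 0 j`; prepending
-- `1F` does the same with the edges exchanged. Hence `τ` amounts to exchanging the edges.
table : Word → Table
table []       = scale unitColumn
table (0F ∷ u) = scale (table u)
table (1F ∷ u) = transpose (scale (transpose (table u)))

table-isDifferenceTable : ∀ u → IsDifferenceTable (table u)
table-isDifferenceTable []       = scale-isDifferenceTable unitColumn-isDifferenceTable
table-isDifferenceTable (0F ∷ u) = scale-isDifferenceTable (table-isDifferenceTable u)
table-isDifferenceTable (1F ∷ u) = transpose-isDifferenceTable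
  (scale-isDifferenceTable (transpose-isDifferenceTable (table-isDifferenceTable u)))

summand : Index → ℕ → ℚ
summand (k ∷ ks) j = 1/[1+ j ]^ value k * ζ⋆List (suc j) ks

ζ⋆≡Σ< : ∀ k n → ζ⋆ n k ≡ Σ< (summand k) n
ζ⋆≡Σ< (k ∷ ks) n = sumℚ≡Σ< (summand (k ∷ ks)) n

summand-0 : ∀ u j → summand (unword (0F ∷ u)) j ≡ recip j * summand (unword u) j
summand-0 u j with unword u
... | k ∷ ks = trans (cong (_* ζ⋆List (suc j) ks) (1/[1+]^-suc j (value k)))
  (ℚₚ.*-assoc (recip j) _ _)

-- The letter 1 inserts a new leading entry 1, so the former outermost variable is now summed up to
-- j+1.
summand-1 : ∀ u j → summand (unword (1F ∷ u)) j ≡ recip j * Σ< (summand (unword u)) (suc j)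
summand-1 u j with unword u
... | k ∷ ks = cong (recip j *_) (ζ⋆≡Σ< (k ∷ ks) (suc j))

-- Letter by letter, the edges of `table` obey the recurrences `summand-0` and `summand-1`, with the
-- two letters interchanged on the second edge.
table-row : ∀ u i → table u i 0 ≡ summand (unword u) i
table-column : ∀ u j → table u 0 j ≡ summand (unword (τ u)) j

table-row []       i = refl
table-row (0F ∷ u) i = trans (cong (recip i *_) (table-row u i)) (sym (summand-0 u i))
table-row (1F ∷ u) i = trans (scale-column (transpose (table u)) i)
  (trans (cong (recip i *_) (Σ<-cong (suc i) λ j _ → table-row u j)) (sym (summand-1 u i)))

table-column []       j = trans (scale-column unitColumn j) (cong (recip j *_) (sum-unit j))
  where
  sum-unit : ∀ j → Σ< (unitColumn 0) (suc j) ≡ 1ℚ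
  sum-unit zero    = refl
  sum-unit (suc j) = trans (ℚₚ.+-identityʳ _) (sum-unit j)
table-column (0F ∷ u) j = trans (scale-column (table u) j)
  (trans (cong (recip j *_) (Σ<-cong (suc j) λ i _ → table-column u i)) (sym (summand-1 (τ u) j)))
table-column (1F ∷ u) j = trans (cong (recip j *_) (table-column u j)) (sym (summand-0 (τ u) j))

-- The binomial transform

-- (-1)ⁿ C(q, n), by Pascal's rule.
signedBinomial : ℕ → ℕ → ℚ
signedBinomial q       zero    = 1ℚ
signedBinomial zero    (suc n) = 0ℚ
signedBinomial (suc q) (suc n) = signedBinomial q (suc n) - signedBinomial q n

-- Induction on `q`: Pascal's rule leads to the same ratio at `n` and n+1. This later cancels the
-- factor -(n+1)/(q-n) of `resummed`.
signedBinomial-ratio : ∀ q n → fromℕ (suc n) * signedBinomial q (suc n) ≡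
                               (fromℕ n - fromℕ q) * signedBinomial q n
signedBinomial-ratio zero    zero    = refl
signedBinomial-ratio zero    (suc n) = alg (fromℕ n)
  where
  alg : ∀ n → (1ℚ + (1ℚ + n)) * 0ℚ ≡ (1ℚ + n - 0ℚ) * 0ℚ
  alg = solve-∀ ℚ-ring
signedBinomial-ratio (suc q) zero    = begin
  fromℕ 1 * (signedBinomial q 1 - 1ℚ)           ≡⟨ split (signedBinomial q 1) ⟩
  fromℕ 1 * signedBinomial q 1 - 1ℚ             ≡⟨ cong (_- 1ℚ) (signedBinomial-ratio q 0) ⟩
  (0ℚ - fromℕ q) * 1ℚ - 1ℚ                      ≡⟨ regroup (fromℕ q) ⟩
  (0ℚ - fromℕ (suc q)) * 1ℚ                     ∎
  where
  split : ∀ b → (1ℚ + 0ℚ) * (b - 1ℚ) ≡ (1ℚ + 0ℚ) * b - 1ℚ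
  split = solve-∀ ℚ-ring
  regroup : ∀ q → (0ℚ - q) * 1ℚ - 1ℚ ≡ (0ℚ - (1ℚ + q)) * 1ℚ
  regroup = solve-∀ ℚ-ring
signedBinomial-ratio (suc q) (suc n) = begin
  fromℕ (2 ℕ.+ n) * (b₂ - b₁)
    ≡⟨ split (fromℕ n) b₂ b₁ ⟩
  fromℕ (2 ℕ.+ n) * b₂ - (b₁ + fromℕ (suc n) * b₁)
    ≡⟨ cong₂ (λ s t → s - (b₁ + t)) (signedBinomial-ratio q (suc n)) (signedBinomial-ratio q n) ⟩
  (fromℕ (suc n) - fromℕ q) * b₁ - (b₁ + (fromℕ n - fromℕ q) * b₀)
    ≡⟨ regroup (fromℕ n) (fromℕ q) b₁ b₀ ⟩
  (fromℕ (suc n) - fromℕ (suc q)) * (b₁ - b₀)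
    ∎
  where
  b₀ = signedBinomial q n
  b₁ = signedBinomial q (suc n)
  b₂ = signedBinomial q (2 ℕ.+ n)
  split : ∀ n b c → (1ℚ + (1ℚ + n)) * (b - c) ≡ (1ℚ + (1ℚ + n)) * b - (c + (1ℚ + n) * c)
  split = solve-∀ ℚ-ring
  regroup : ∀ n q b c → (1ℚ + n - q) * b - (b + (n - q) * c) ≡ (1ℚ + n - (1ℚ + q)) * (b - c)
  regroup = solve-∀ ℚ-ring

signedBinomial-vanish : ∀ {q n} → q < n → signedBinomial q n ≡ 0ℚ
signedBinomial-vanish {zero}  (s≤s _)   = refl
signedBinomial-vanish {suc q} (s≤s q<n) =
  cong₂ _-_ (signedBinomial-vanish (ℕₚ.m<n⇒m<1+n q<n)) (signedBinomial-vanish q<n)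

signedBinomial-diagonal-suc : ∀ q → signedBinomial (suc q) (suc q) ≡ - signedBinomial q q
signedBinomial-diagonal-suc q =
  trans (cong (_- signedBinomial q q) (signedBinomial-vanish (ℕₚ.n<1+n q))) (ℚₚ.+-identityˡ _)

-- The diagonal entry is (-1)^q with `q` even; the induction lowers `q` by two. This is where
-- oddness of the prime enters.
signedBinomial-diagonal : ∀ q → 2 ∤ suc q → signedBinomial q q ≡ 1ℚ
signedBinomial-diagonal 0             odd = refl
signedBinomial-diagonal 1             odd = ⊥-elim (odd ℕ∣.∣-refl)
signedBinomial-diagonal (suc (suc q)) odd = begin
  signedBinomial (2 ℕ.+ q) (2 ℕ.+ q)    ≡⟨ signedBinomial-diagonal-suc (suc q) ⟩
  - signedBinomial (suc q) (suc q)      ≡⟨ cong -_ (signedBinomial-diagonal-suc q) ⟩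
  - - signedBinomial q q                ≡⟨ cong (λ t → - - t) (signedBinomial-diagonal q (odd ∘ ℕ∣.∣m∣n⇒∣m+n ℕ∣.∣-refl)) ⟩
  1ℚ                                    ∎

-- Pascal's rule summed against `a`. The term at 0 has no second part, so the shifted sum is one
-- term shorter.
Σ<-signedBinomial-suc : ∀ q (a : ℕ → ℚ) m →
  Σ< (λ n → signedBinomial (suc q) n * a n) (suc m) ≡
  Σ< (λ n → signedBinomial q n * a n) (suc m) - Σ< (λ n → signedBinomial q n * a (suc n)) m
Σ<-signedBinomial-suc q a zero    = alg (a 0)
  where
  alg : ∀ x → 0ℚ + 1ℚ * x ≡ 0ℚ + 1ℚ * x - 0ℚ
  alg = solve-∀ ℚ-ring
Σ<-signedBinomial-suc q a (suc m) =
  trans (cong (_+ signedBinomial (suc q) (suc m) * a (suc m)) (Σ<-signedBinomial-suc q a m))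
    (alg (Σ< (λ n → signedBinomial q n * a n) (suc m)) (Σ< (λ n → signedBinomial q n * a (suc n)) m)
      (signedBinomial q (suc m)) (signedBinomial q m) (a (suc m)))
  where
  alg : ∀ s t b c x → s - t + (b - c) * x ≡ s + b * x - (t + c * x)
  alg = solve-∀ ℚ-ring

-- Induction on `q` over all tables: X 0 (q+1) = X 0 q - X 1 q, and dropping row 0 leaves a
-- difference table.
column≡Σ<row : ∀ {X} → IsDifferenceTable X → ∀ q →
               X 0 q ≡ Σ< (λ n → signedBinomial q n * X n 0) (suc q)
column≡Σ<row {X} d zero    = sym (trans (ℚₚ.+-identityˡ _) (ℚₚ.*-identityˡ (X 0 0)))
column≡Σ<row {X} d (suc q) = begin
  X 0 (suc q)
    ≡⟨ isolate (X 1 q) (X 0 (suc q)) ⟩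
  X 1 q + X 0 (suc q) - X 1 q
    ≡⟨ cong (_- X 1 q) (d 0 q) ⟨
  X 0 q - X 1 q
    ≡⟨ cong₂ _-_ (column≡Σ<row d q) (column≡Σ<row {λ i → X (suc i)} (λ i → d (suc i)) q) ⟩
  Σ< f (suc q) - Σ< (λ n → signedBinomial q n * X (suc n) 0) (suc q)
    ≡⟨ cong (_- Σ< (λ n → signedBinomial q n * X (suc n) 0) (suc q)) extend ⟨
  Σ< f (2 ℕ.+ q) - Σ< (λ n → signedBinomial q n * X (suc n) 0) (suc q)
    ≡⟨ Σ<-signedBinomial-suc q (λ n → X n 0) (suc q) ⟨
  Σ< (λ n → signedBinomial (suc q) n * X n 0) (2 ℕ.+ q)
    ∎
  where
  f = λ n → signedBinomial q n * X n 0
  isolate : ∀ a b → b ≡ a + b - a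
  isolate = solve-∀ ℚ-ring
  alg : ∀ s x → s + 0ℚ * x ≡ s
  alg = solve-∀ ℚ-ring
  extend : Σ< f (2 ℕ.+ q) ≡ Σ< f (suc q)
  extend = trans (cong (λ t → Σ< f (suc q) + t * X (suc q) 0) (signedBinomial-vanish (ℕₚ.n<1+n q)))
    (alg (Σ< f (suc q)) (X (suc q) 0))

-- The geometric resummation

-- For N ≤ q and p = q + 1 this is ∑_{n ≤ N} a(n-1) ∏_{m=n}^{N} (1 - p/m)⁻¹, where
-- (1 - p/m)⁻¹ = - m / (p - m); for N > q truncated subtraction makes it junk.
resummed : (ℕ → ℚ) → ℕ → ℕ → ℚ
resummed a q zero    = 0ℚ
resummed a q (suc n) = - (fromℕ (suc n) * recip (q ∸ suc n)) * (resummed a q n + a n)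

fromℕ-∸ : ∀ {m n} → n ≤ m → fromℕ (m ∸ n) ≡ fromℕ m - fromℕ n
fromℕ-∸ {m} z≤n = sym (ℚₚ.+-identityʳ (fromℕ m))
fromℕ-∸ {suc m} {suc n} (s≤s n≤m) = trans (fromℕ-∸ n≤m) (alg (fromℕ m) (fromℕ n))
  where
  alg : ∀ m n → m - n ≡ 1ℚ + m - (1ℚ + n)
  alg = solve-∀ ℚ-ring

-- `recip j` is 1/(j+1), so for `n < q` the reciprocal in `resummed` is 1/(q-n).
[q-n]*recip : ∀ {q n} → n < q → (fromℕ q - fromℕ n) * recip (q ∸ suc n) ≡ 1ℚ
[q-n]*recip {suc q} {n} (s≤s n≤q) = begin
  (1ℚ + fromℕ q - fromℕ n) * recip (q ∸ n)     ≡⟨ cong (_* recip (q ∸ n)) (ℚₚ.+-assoc 1ℚ (fromℕ q) _) ⟩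
  (1ℚ + (fromℕ q - fromℕ n)) * recip (q ∸ n)   ≡⟨ cong (λ t → (1ℚ + t) * recip (q ∸ n)) (fromℕ-∸ n≤q) ⟨
  fromℕ (suc (q ∸ n)) * recip (q ∸ n)          ≡⟨ fromℕ*recip (q ∸ n) ⟩
  1ℚ                                           ∎

module _ (a : ℕ → ℚ) (q : ℕ) where

  private
    F = resummed a q

  -- With p = q+1, 1 - p/(n+1) = -(q-n)/(n+1), so the definition says (1 - p/(n+1)) F (n+1) = F n +
  -- a n. Keeping the p-term on the right makes the equation iterable.
  resummed-recurrence : ∀ {n} → n < q → F (suc n) ≡ F n + a n + fromℕ (suc q) * (recip n * F (suc n))
  resummed-recurrence {n} n<q = begin
    - (N * r) * x
      -- Here n+1 is written as p - (q-n), with p = q+1.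
      ≡⟨ isolate (fromℕ q) (fromℕ n) r x ⟩
    ((fromℕ q - fromℕ n) * r) * x + fromℕ (suc q) * - (r * x)
      ≡⟨ cong₂ (λ s t → s * x + fromℕ (suc q) * - t) ([q-n]*recip n<q) (absorb _ _ ) ⟩
    1ℚ * x + fromℕ (suc q) * - (recip n * (N * r * x))
      ≡⟨ regroup x (fromℕ (suc q)) (recip n) (N * r) ⟩
    x + fromℕ (suc q) * (recip n * (- (N * r) * x))
      ∎
    where
    N = fromℕ (suc n)
    r = recip (q ∸ suc n)
    x = F n + a n
    isolate : ∀ q n r x → - ((1ℚ + n) * r) * x ≡ ((q - n) * r) * x + (1ℚ + q) * - (r * x)
    isolate = solve-∀ ℚ-ring
    regroup : ∀ x p s t → 1ℚ * x + p * - (s * (t * x)) ≡ x + p * (s * (- t * x))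
    regroup = solve-∀ ℚ-ring
    assoc : ∀ s n r x → (n * s) * (r * x) ≡ s * (n * r * x)
    assoc = solve-∀ ℚ-ring
    absorb : ∀ r x → r * x ≡ recip n * (N * r * x)
    absorb r x = trans (sym (ℚₚ.*-identityˡ (r * x)))
      (trans (cong (_* (r * x)) (sym (fromℕ*recip n))) (assoc (recip n) N r x))

  -- The recurrence telescopes. The sum multiplied by q+1 has the shape in which a leading 1 is
  -- prepended to an index.
  resummed-unfold : ∀ {n} → n ≤ q →
                    F n ≡ Σ< a n + fromℕ (suc q) * Σ< (λ j → recip j * F (suc j)) n
  resummed-unfold {zero}  _   = alg (fromℕ (suc q))
    where
    alg : ∀ c → 0ℚ ≡ 0ℚ + c * 0ℚ
    alg = solve-∀ ℚ-ring
  resummed-unfold {suc n} n<q = begin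
    F (suc n)
      ≡⟨ resummed-recurrence n<q ⟩
    F n + a n + c * t
      ≡⟨ cong (λ s → s + a n + c * t) (resummed-unfold (ℕₚ.<⇒≤ n<q)) ⟩
    Σ< a n + c * Σ< (λ j → recip j * F (suc j)) n + a n + c * t
      ≡⟨ regroup (Σ< a n) (Σ< (λ j → recip j * F (suc j)) n) (a n) t c ⟩
    Σ< a (suc n) + c * Σ< (λ j → recip j * F (suc j)) (suc n)
      ∎
    where
    c = fromℕ (suc q)
    t = recip n * F (suc n)
    regroup : ∀ s u x t c → s + c * u + x + c * t ≡ s + x + c * (u + t)
    regroup = solve-∀ ℚ-ring

  -- By `signedBinomial-ratio`, the coefficient at n+1 absorbs the factor of `resummed` and becomes
  -- the coefficient at `n`, leaving a running sum.
  signedBinomial*resummed : ∀ {n} → n ≤ q →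
    signedBinomial q n * F n ≡ Σ< (λ j → signedBinomial q j * a j) n
  signedBinomial*resummed {zero}  _   = refl
  signedBinomial*resummed {suc n} n<q = begin
    b′ * (- (N * r) * x)
      ≡⟨ assoc b′ N r x ⟩
    - (N * b′) * r * x
      ≡⟨ cong (λ t → - t * r * x) (signedBinomial-ratio q n) ⟩
    - ((fromℕ n - fromℕ q) * b) * r * x
      ≡⟨ regroup (fromℕ n) (fromℕ q) b r x ⟩
    ((fromℕ q - fromℕ n) * r) * (b * x)
      ≡⟨ cong (_* (b * x)) ([q-n]*recip n<q) ⟩
    1ℚ * (b * x)
      ≡⟨ trans (ℚₚ.*-identityˡ (b * x)) (ℚₚ.*-distribˡ-+ b (F n) (a n)) ⟩
    b * F n + b * a n
      ≡⟨ cong (_+ b * a n) (signedBinomial*resummed (ℕₚ.<⇒≤ n<q)) ⟩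
    Σ< (λ j → signedBinomial q j * a j) (suc n)
      ∎
    where
    b = signedBinomial q n
    b′ = signedBinomial q (suc n)
    N = fromℕ (suc n)
    r = recip (q ∸ suc n)
    x = F n + a n
    assoc : ∀ b n r x → b * (- (n * r) * x) ≡ - (n * b) * r * x
    assoc = solve-∀ ℚ-ring
    regroup : ∀ n q b r x → - ((n - q) * b) * r * x ≡ ((q - n) * r) * (b * x)
    regroup = solve-∀ ℚ-ring

resummed-cong : ∀ {a b} q n → (∀ j → a j ≡ b j) → resummed a q n ≡ resummed b q n
resummed-cong q zero    a≡b = refl
resummed-cong q (suc n) a≡b =
  cong (- (fromℕ (suc n) * recip (q ∸ suc n)) *_) (cong₂ _+_ (resummed-cong q n a≡b) (a≡b n))

-- At `n = q` the running sum is the binomial transform without its last term, which is `X q 0`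
-- because its coefficient is 1.
resummed-row : ∀ {X} → IsDifferenceTable X → ∀ q → 2 ∤ suc q →
               resummed (λ i → X i 0) q q ≡ X 0 q - X q 0
resummed-row {X} d q odd = begin
  F                                   ≡⟨ isolate F (X q 0) ⟩
  1ℚ * F + 1ℚ * X q 0 - X q 0         ≡⟨ cong (λ b → b * F + b * X q 0 - X q 0) (signedBinomial-diagonal q odd) ⟨
  b * F + b * X q 0 - X q 0           ≡⟨ cong (λ s → s + b * X q 0 - X q 0) (signedBinomial*resummed (λ i → X i 0) q ℕₚ.≤-refl) ⟩
  Σ< (λ n → signedBinomial q n * X n 0) (suc q) - X q 0
                                      ≡⟨ cong (_- X q 0) (column≡Σ<row d q) ⟨
  X 0 q - X q 0                       ∎
  where
  F = resummed (λ i → X i 0) q q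
  b = signedBinomial q q
  isolate : ∀ f x → f ≡ 1ℚ * f + 1ℚ * x - x
  isolate = solve-∀ ℚ-ring

resummed-duality : ∀ u q → 2 ∤ suc q →
  resummed (summand (unword u)) q q ≡ - resummed (summand (unword (τ u))) q q
resummed-duality u q odd = begin
  resummed (summand (unword u)) q q          ≡⟨ resummed-cong q q (table-row u) ⟨
  resummed (λ i → X i 0) q q                 ≡⟨ resummed-row (table-isDifferenceTable u) q odd ⟩
  X 0 q - X q 0                              ≡⟨ swap (X 0 q) (X q 0) ⟩
  - (X q 0 - X 0 q)                          ≡⟨ cong -_ (resummed-row (transpose-isDifferenceTable (table-isDifferenceTable u)) q odd) ⟨
  - resummed (λ j → X 0 j) q q               ≡⟨ cong -_ (resummed-cong q q (table-column u)) ⟩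
  - resummed (summand (unword (τ u))) q q    ∎
  where
  X = table u
  swap : ∀ a b → a - b ≡ - (b - a)
  swap = solve-∀ ℚ-ring

-- Iterating resummed-unfold m times leaves pᵐ times this remainder.
remainder : (ℕ → ℚ) → ℕ → ℕ → ℕ → ℚ
remainder a q zero    n = resummed a q n
remainder a q (suc m) n = Σ< (λ j → recip j * remainder a q m (suc j)) n

ζ⋆-prependOnes-suc : ∀ i k n → ζ⋆ n (prependOnes (suc i) k) ≡
                     Σ< (λ j → recip j * ζ⋆ (suc j) (prependOnes i k)) n
ζ⋆-prependOnes-suc zero    (k ∷ ks) n = sumℚ≡Σ< _ n
ζ⋆-prependOnes-suc (suc i) (k ∷ ks) n = sumℚ≡Σ< _ n

-- Each step applies the linear operator f ↦ ∑ f(j+1)/(j+1), which prepends a 1 in ζ⋆ and raises the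
-- order of the remainder.
remainder-unfold : ∀ k q m {n} → n ≤ q → remainder (summand k) q m n ≡
  ζ⋆ n (prependOnes m k) + fromℕ (suc q) * remainder (summand k) q (suc m) n
remainder-unfold k q zero    {n} n≤q =
  trans (resummed-unfold (summand k) q n≤q)
    (cong (_+ fromℕ (suc q) * remainder (summand k) q 1 n) (sym (ζ⋆≡Σ< k n)))
remainder-unfold k q (suc m) {n} n≤q = begin
  Σ< (λ j → recip j * R m (suc j)) n
    ≡⟨ Σ<-cong n (λ j j<n → trans (cong (recip j *_) (remainder-unfold k q m (ℕₚ.≤-trans j<n n≤q)))
         (distrib (recip j) (ζ⋆ (suc j) (prependOnes m k)) c (R (suc m) (suc j)))) ⟩
  Σ< (λ j → recip j * ζ⋆ (suc j) (prependOnes m k) + c * (recip j * R (suc m) (suc j))) n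
    ≡⟨ Σ<-linear _ _ c n ⟩
  Σ< (λ j → recip j * ζ⋆ (suc j) (prependOnes m k)) n + c * R (2 ℕ.+ m) n
    ≡⟨ cong (_+ c * R (2 ℕ.+ m) n) (ζ⋆-prependOnes-suc m k n) ⟨
  ζ⋆ n (prependOnes (suc m) k) + c * R (2 ℕ.+ m) n
    ∎
  where
  R = remainder (summand k) q
  c = fromℕ (suc q)
  distrib : ∀ r z c x → r * (z + c * x) ≡ r * z + c * (r * x)
  distrib = solve-∀ ℚ-ring

infixr 8 _^ℚ_
-- Follows the recursion of `_^Â_`, so `residue-𝒑^` can proceed in parallel.
_^ℚ_ : ℚ → ℕ → ℚ
x ^ℚ zero  = 1ℚ
x ^ℚ suc n = x * x ^ℚ n

-- Iterating `remainder-unfold` gives an exact rational identity for each `m`; no limit is taken in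
-- ℚ.
resummed-expansion : ∀ k q m → resummed (summand k) q q ≡
  Σ< (λ i → ζ⋆ q (prependOnes i k) * fromℕ (suc q) ^ℚ i) m +
  fromℕ (suc q) ^ℚ m * remainder (summand k) q m q
resummed-expansion k q zero    = alg (resummed (summand k) q q)
  where
  alg : ∀ x → x ≡ 0ℚ + 1ℚ * x
  alg = solve-∀ ℚ-ring
resummed-expansion k q (suc m) = begin
  resummed (summand k) q q
    ≡⟨ resummed-expansion k q m ⟩
  s + c ^ℚ m * R m
    ≡⟨ cong (λ t → s + c ^ℚ m * t) (remainder-unfold k q m ℕₚ.≤-refl) ⟩
  s + c ^ℚ m * (z + c * R (suc m))
    ≡⟨ regroup s (c ^ℚ m) z c (R (suc m)) ⟩
  s + z * c ^ℚ m + c ^ℚ suc m * R (suc m)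
    ∎
  where
  R = λ m → remainder (summand k) q m q
  c = fromℕ (suc q)
  z = ζ⋆ q (prependOnes m k)
  s = Σ< (λ i → ζ⋆ q (prependOnes i k) * c ^ℚ i) m
  regroup : ∀ s e z c x → s + e * (z + c * x) ≡ s + z * e + (c * e) * x
  regroup = solve-∀ ℚ-ring

-- Passage to Â

∤1 : (p : ℙ) → proj₁ p ∤ 1
∤1 (p , P) p∣1 = ℕ.nonTrivial⇒≢1 {{prime⇒nonTrivial P}} (ℕ∣.∣1⇒≡1 p∣1)

integral-neg : ∀ p x → Integral p x → Integral p (- x)
integral-neg p x h = subst (proj₁ p ∤_) (sym (ℤₚ.+-injective (ℚₚ.↧-neg x))) h

integral-fromℕ : ∀ p n → Integral p (fromℕ n)
integral-fromℕ p zero    = ∤1 p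
integral-fromℕ p (suc n) = integral-+ p 1ℚ (fromℕ n) (∤1 p) (integral-fromℕ p n)

integral-Σ< : ∀ p f n → (∀ j → j < n → Integral p (f j)) → Integral p (Σ< f n)
integral-Σ< p f zero    h = ∤1 p
integral-Σ< p f (suc n) h = integral-+ p (Σ< f n) (f n)
  (integral-Σ< p f n λ j j<n → h j (ℕₚ.m<n⇒m<1+n j<n)) (h n ℕₚ.≤-refl)

integral-recip : ∀ p j → suc j < proj₁ p → Integral p (recip j)
integral-recip p j = integral-1/ p j 1

integral-summand : ∀ p k j → suc j < proj₁ p → Integral p (summand k j)
integral-summand p (k ∷ ks) j 1+j<p = integral-* p (1/[1+ j ]^ value k) (ζ⋆List (suc j) ks)
  (integral-1/ p j (value k) 1+j<p) (integral-ζ⋆List p (suc j) ks 1+j<p)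

module _ {p : ℙ} {q : ℕ} (q<p : q < proj₁ p) {a : ℕ → ℚ}
         (a-integral : ∀ j → suc j < proj₁ p → Integral p (a j)) where

  -- Besides those of `a`, the denominators are the numbers q-n with `n < q`, all positive and below
  -- p.
  integral-resummed : ∀ {n} → n ≤ q → Integral p (resummed a q n)
  integral-resummed {zero}  _   = ∤1 p
  integral-resummed {suc n} n<q =
    integral-* p (- (fromℕ (suc n) * r)) (resummed a q n + a n)
      (integral-neg p (fromℕ (suc n) * r)
        (integral-* p (fromℕ (suc n)) r (integral-fromℕ p (suc n))
          (integral-recip p (q ∸ suc n)
            (ℕₚ.≤-<-trans (ℕₚ.∸-monoʳ-< (s≤s z≤n) n<q) q<p))))
      (integral-+ p (resummed a q n) (a n) (integral-resummed (ℕₚ.<⇒≤ n<q))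
        (a-integral n (ℕₚ.≤-<-trans n<q q<p)))
    where r = recip (q ∸ suc n)

  -- Integrality for every `m` ensures that p^m times the remainder tends to 0 p-adically.
  integral-remainder : ∀ m {n} → n ≤ q → Integral p (remainder a q m n)
  integral-remainder zero        n≤q = integral-resummed n≤q
  integral-remainder (suc m) {n} n≤q = integral-Σ< p _ n λ j j<n →
    integral-* p (recip j) (remainder a q m (suc j))
      (integral-recip p j (ℕₚ.≤-<-trans (ℕₚ.≤-trans j<n n≤q) q<p))
      (integral-remainder m (ℕₚ.≤-trans j<n n≤q))

-- Residues of p-integral rationals

*-cancelʳ-mod : ∀ {b m x y} → Coprime b m → x ℤ.* ℤ.+ b ≡ y ℤ.* ℤ.+ b [mod m ] → x ≡ y [mod m ]
*-cancelʳ-mod {b} {m} {x} {y} c eq =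
  mod-trans (mod-sym (unfold x)) (mod-trans (mod-* eq (≡⇒mod refl)) (unfold y))
  where
  b⁻¹ = proj₁ (inverse c)
  unfold : ∀ x → x ℤ.* ℤ.+ b ℤ.* b⁻¹ ≡ x [mod m ]
  unfold x = mod-trans (≡⇒mod (ℤₚ.*-assoc x (ℤ.+ b) b⁻¹))
    (mod-trans (mod-* (≡⇒mod {x = x} refl) (proj₂ (inverse c))) (≡⇒mod (ℤₚ.*-identityʳ x)))

-- z represents the p-integral rational x in ℤ/pⁿ.
record Residue (p : ℙ) (n : ℕ) (x : ℚ) (z : ℤ) : Set where
  constructor mkResidue
  field
    integral   : Integral p x
    congruence : ℚ.↥ x ≡ z ℤ.* ℚ.↧ x [mod proj₁ p ℕ.^ n ]

open Residue

module _ {p : ℙ} {n : ℕ} where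

  private
    coprime : ∀ x → Integral p x → Coprime (ℚ.↧ₙ x) (proj₁ p ℕ.^ n)
    coprime x h = coprime-^ p h n

    -- Reduction to lowest terms removes a common factor `g`. Multiplying by the denominators of `x`
    -- and `y`, which are units modulo pⁿ, avoids cancelling `g`.
    unnormalised : ∀ x y s g {num} z → Integral p x → Integral p y →
      ℚ.↥ s ℤ.* g ≡ num → ℚ.↧ s ℤ.* g ≡ ℚ.↧ x ℤ.* ℚ.↧ y →
      num ≡ z ℤ.* (ℚ.↧ x ℤ.* ℚ.↧ y) [mod proj₁ p ℕ.^ n ] →
      ℚ.↥ s ≡ z ℤ.* ℚ.↧ s [mod proj₁ p ℕ.^ n ]
    unnormalised x y s g {num} z hx hy ↥s ↧s eq =
      *-cancelʳ-mod (coprime x hx) (*-cancelʳ-mod (coprime y hy) (mod-trans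
        (≡⇒mod (begin
          ℚ.↥ s ℤ.* ℚ.↧ x ℤ.* ℚ.↧ y        ≡⟨ ℤₚ.*-assoc (ℚ.↥ s) (ℚ.↧ x) (ℚ.↧ y) ⟩
          ℚ.↥ s ℤ.* (ℚ.↧ x ℤ.* ℚ.↧ y)      ≡⟨ cong (ℚ.↥ s ℤ.*_) ↧s ⟨
          ℚ.↥ s ℤ.* (ℚ.↧ s ℤ.* g)          ≡⟨ swap (ℚ.↥ s) (ℚ.↧ s) g ⟩
          ℚ.↥ s ℤ.* g ℤ.* ℚ.↧ s            ≡⟨ cong (ℤ._* ℚ.↧ s) ↥s ⟩
          num ℤ.* ℚ.↧ s                    ∎))
        (mod-trans (mod-* eq (≡⇒mod {x = ℚ.↧ s} refl))
          (≡⇒mod (regroup z (ℚ.↧ x) (ℚ.↧ y) (ℚ.↧ s))))))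
      where
      swap : ∀ a b g → a ℤ.* (b ℤ.* g) ≡ a ℤ.* g ℤ.* b
      swap = ℤ-solve-∀
      regroup : ∀ z x y s → z ℤ.* (x ℤ.* y) ℤ.* s ≡ z ℤ.* s ℤ.* x ℤ.* y
      regroup = ℤ-solve-∀

  residue-fromℚ : ∀ x (h : Integral p x) → Residue p n x (at (fromℚ p x h) n)
  residue-fromℚ x h = mkResidue h (mod-sym (mod-trans
    (≡⇒mod (swap (ℚ.↥ x) (proj₁ (inverse (coprime x h))) (ℚ.↧ x)))
    (mod-trans (mod-* (≡⇒mod {x = ℚ.↥ x} refl) (proj₂ (inverse (coprime x h))))
      (≡⇒mod (ℤₚ.*-identityʳ (ℚ.↥ x))))))
    where
    swap : ∀ a b c → a ℤ.* b ℤ.* c ≡ a ℤ.* (c ℤ.* b)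
    swap = ℤ-solve-∀

  -- The denominator is a unit modulo pⁿ. This turns identities in ℚ into congruences.
  residue-unique : ∀ {x z w} → Residue p n x z → Residue p n x w → z ≡ w [mod proj₁ p ℕ.^ n ]
  residue-unique {x} a b =
    *-cancelʳ-mod (coprime x (integral a)) (mod-trans (mod-sym (congruence a)) (congruence b))

  residue-+ : ∀ {x y z w} → Residue p n x z → Residue p n y w → Residue p n (x + y) (z ℤ.+ w)
  residue-+ {x} {y} {z} {w} (mkResidue hx x≡z) (mkResidue hy y≡w) = mkResidue
    (integral-+ p x y hx hy)
    (unnormalised x y (x + y) _ (z ℤ.+ w) hx hy (ℚₚ.↥-+ x y) (ℚₚ.↧-+ x y) (mod-trans
      (mod-+ (mod-* x≡z (≡⇒mod {x = ℚ.↧ y} refl)) (mod-* y≡w (≡⇒mod {x = ℚ.↧ x} refl)))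
      (≡⇒mod (regroup z w (ℚ.↧ x) (ℚ.↧ y)))))
    where
    regroup : ∀ z w x y → z ℤ.* x ℤ.* y ℤ.+ w ℤ.* y ℤ.* x ≡ (z ℤ.+ w) ℤ.* (x ℤ.* y)
    regroup = ℤ-solve-∀

  residue-* : ∀ {x y z w} → Residue p n x z → Residue p n y w → Residue p n (x * y) (z ℤ.* w)
  residue-* {x} {y} {z} {w} (mkResidue hx x≡z) (mkResidue hy y≡w) = mkResidue
    (integral-* p x y hx hy)
    (unnormalised x y (x * y) _ (z ℤ.* w) hx hy (ℚₚ.↥-* x y) (ℚₚ.↧-* x y) (mod-trans
      (mod-* x≡z y≡w) (≡⇒mod (regroup z w (ℚ.↧ x) (ℚ.↧ y)))))
    where
    regroup : ∀ z w x y → (z ℤ.* x) ℤ.* (w ℤ.* y) ≡ (z ℤ.* w) ℤ.* (x ℤ.* y)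
    regroup = ℤ-solve-∀

  residue-neg : ∀ {x z} → Residue p n x z → Residue p n (- x) (ℤ.- z)
  residue-neg {x} {z} (mkResidue hx x≡z) = mkResidue (integral-neg p x hx)
    (mod-trans (≡⇒mod (ℚₚ.↥-neg x)) (mod-trans (mod-neg x≡z)
      (≡⇒mod (trans (ℤₚ.neg-distribˡ-* z (ℚ.↧ x)) (cong (ℤ.- z ℤ.*_) (sym (ℚₚ.↧-neg x)))))))

  residue-fromℕ : ∀ m → Residue p n (fromℕ m) (ℤ.+ m)
  residue-fromℕ zero    = mkResidue (∤1 p) (≡⇒mod refl)
  residue-fromℕ (suc m) = residue-+ {1ℚ} {fromℕ m} {ℤ.+ 1} (mkResidue (∤1 p) (≡⇒mod refl)) (residue-fromℕ m)

  -- Stated with `sumℚ` because `partialSum` also peels off its first term.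
  residue-partialSum : ∀ m (g : ℕ → ℚ) (f : ℕ → Â.Carrier) →
    (∀ i → Residue p n (g i) (at (f i) n p)) →
    Residue p n (sumℚ {m} (λ i → g (toℕ i))) (at (partialSum f m) n p)
  residue-partialSum zero    g f h = mkResidue (∤1 p) (≡⇒mod refl)
  residue-partialSum (suc m) g f h =
    residue-+ (h 0) (residue-partialSum m (g ∘ suc) (f ∘ suc) (h ∘ suc))

  residue-𝒑^ : ∀ i → Residue p n (fromℕ (proj₁ p) ^ℚ i) (at (𝒑 ^Â i) n p)
  residue-𝒑^ zero    = mkResidue (∤1 p) (≡⇒mod refl)
  residue-𝒑^ (suc i) = residue-* (residue-fromℕ (proj₁ p)) (residue-𝒑^ i)

-- Convergence of the series

𝒑^-at : ∀ m n p → at (𝒑 ^Â m) n p ≡ ℤ.+ (proj₁ p ℕ.^ m)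
𝒑^-at zero    n p = refl
𝒑^-at (suc m) n p =
  trans (cong (ℤ.+ proj₁ p ℤ.*_) (𝒑^-at m n p)) (sym (ℤₚ.pos-* (proj₁ p) (proj₁ p ℕ.^ m)))

^-monoʳ-∣ : ∀ b {m n} → m ≤ n → b ℕ.^ m ∣ b ℕ.^ n
^-monoʳ-∣ b z≤n       = ℕ∣.1∣ _
^-monoʳ-∣ b (s≤s m≤n) = ℕ∣.*-monoʳ-∣ b (^-monoʳ-∣ b m≤n)

𝒑^-vanishes : ∀ {m n} p → n ≤ m → at (𝒑 ^Â m) n p ≡ ℤ.+ 0 [mod proj₁ p ℕ.^ n ]
𝒑^-vanishes {m} {n} p n≤m = mod-trans (≡⇒mod (𝒑^-at m n p))
  (mkMod (subst (ℤ.+ (proj₁ p ℕ.^ n) ℤ∣.∣_) (sym (ℤₚ.+-identityʳ (ℤ.+ (proj₁ p ℕ.^ m))))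
    (ℤ∣.∣ᵤ⇒∣ (^-monoʳ-∣ (proj₁ p) n≤m))))

limitAt : Index → ℙ → ℚ
limitAt k p = resummed (summand k) (proj₁ p ∸ 1) (proj₁ p ∸ 1)

p∸1<p : (p : ℙ) → proj₁ p ∸ 1 < proj₁ p
p∸1<p (p , P) = ℕₚ.∸-monoʳ-< (s≤s z≤n) (ℕ.>-nonZero⁻¹ p {{prime⇒nonZero P}})

integral-limitAt : ∀ k p → Integral p (limitAt k p)
integral-limitAt k p =
  integral-resummed {p} (p∸1<p p) {summand k} (integral-summand p k) ℕₚ.≤-refl

limit : Index → Â.Carrier
limit k = π λ p → fromℚ p (limitAt k p) (integral-limitAt k p)

limitAt-expansion : ∀ k p m → limitAt k p ≡
  sumℚ {m} (λ i → ζ⋆ (proj₁ p ∸ 1) (prependOnes (toℕ i) k) * fromℕ (proj₁ p) ^ℚ toℕ i) +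
  fromℕ (proj₁ p) ^ℚ m * remainder (summand k) (proj₁ p ∸ 1) m (proj₁ p ∸ 1)
limitAt-expansion k (zero  , P) m = ⊥-elim (ℕ.≢-nonZero⁻¹ 0 {{prime⇒nonZero P}} refl)
limitAt-expansion k (suc q , P) m = trans (resummed-expansion k q m)
  (cong (_+ fromℕ (suc q) ^ℚ m * remainder (summand k) q m q)
    (sym (sumℚ≡Σ< (λ i → ζ⋆ q (prependOnes i k) * fromℕ (suc q) ^ℚ i) m)))

residue-limit : ∀ k p n → Residue p n (limitAt k p) (at (limit k) n p)
residue-limit k p n = residue-fromℚ (limitAt k p) (integral-limitAt k p)

residue-term : ∀ k i p n →
  Residue p n (ζ⋆ (proj₁ p ∸ 1) (prependOnes i k) * fromℕ (proj₁ p) ^ℚ i)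
              (at (ζ⋆Â (prependOnes i k) Â.* 𝒑 ^Â i) n p)
residue-term k i p n = residue-*
  (residue-fromℚ (ζ⋆ (proj₁ p ∸ 1) (prependOnes i k)) (integral-ζ⋆ p (prependOnes i k)))
  (residue-𝒑^ i)

-- The tail of `limitAt-expansion` is p^m times a p-integral number, hence 0 modulo pⁿ.
partialSum≡limit : ∀ k {m n} p → n ≤ m →
                   at (partialSum (λ i → ζ⋆Â (prependOnes i k) Â.* 𝒑 ^Â i) m) n p ≡ at (limit k) n p
                   [mod proj₁ p ℕ.^ n ]
partialSum≡limit k {m} {n} p n≤m = mod-sym (mod-trans
  (residue-unique {p} {n}
    (subst (λ x → Residue p n x (at (limit k) n p)) (limitAt-expansion k p m)
      (residue-limit k p n))
    (residue-+
      (residue-partialSum m g (λ i → ζ⋆Â (prependOnes i k) Â.* 𝒑 ^Â i) λ i → residue-term k i p n)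
      (residue-* (residue-𝒑^ m) (residue-fromℚ R R-integral))))
  (mod-trans (mod-+ (≡⇒mod {x = s} refl) (mod-* (𝒑^-vanishes p n≤m) (≡⇒mod {x = r} refl)))
    (≡⇒mod (ℤₚ.+-identityʳ s))))
  where
  q = proj₁ p ∸ 1
  g = λ i → ζ⋆ q (prependOnes i k) * fromℕ (proj₁ p) ^ℚ i
  R = remainder (summand k) q m q
  R-integral : Integral p R
  R-integral =
    integral-remainder {p} (p∸1<p p) {summand k} (integral-summand p k) m ℕₚ.≤-refl
  s = at (partialSum (λ i → ζ⋆Â (prependOnes i k) Â.* 𝒑 ^Â i) m) n p
  r = at (fromℚ p R R-integral) n

hasSum : ∀ k → HasSum (λ i → ζ⋆Â (prependOnes i k) Â.* 𝒑 ^Â i) (limit k)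
-- The bound `m ≥ n` works at all primes simultaneously.
hasSum k n = n , λ m n≤m → mkEE 0 λ p _ → partialSum≡limit k p n≤m

-- Duality of the limits

2∤prime : ∀ {p} → Prime p → 2 < p → 2 ∤ p
2∤prime P 2<p 2∣p with prime⇒irreducible P 2∣p
... | inj₂ refl = ℕₚ.<-irrefl refl 2<p

-- With `u = dropLast (word k)`, `k ∨` is `unword (τ u)` by definition and `unword-word` recovers
-- `k` as `unword u`.
limitAt-duality : ∀ k p → 2 < proj₁ p → limitAt k p ≡ - limitAt (k ∨) p
limitAt-duality k (suc q , P) 2<p =
  trans (cong (λ l → resummed (summand l) q q) (sym (unword-word k)))
    (resummed-duality (dropLast (word k)) q (2∤prime P 2<p))

limit-duality-at : ∀ k p n → 2 < proj₁ p →
                   at (limit k) n p ≡ ℤ.- at (limit (k ∨)) n p [mod proj₁ p ℕ.^ n ]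
limit-duality-at k p n 2<p = residue-unique {p} {n} (residue-limit k p n)
  (subst (λ x → Residue p n x (ℤ.- at (limit (k ∨)) n p)) (sym (limitAt-duality k p 2<p))
    (residue-neg (residue-limit (k ∨) p n)))

limit-duality : ∀ k → limit k Â.≈ Â.- limit (k ∨)
-- The bound 3 discards p = 2, where `signedBinomial 1 1` is -1.
limit-duality k = mkLE λ n → mkEE 3 λ p → limit-duality-at k p n

theorem1p3 : (k : Index) →
    ∃₂ λ S T →
    HasSum (λ i → ζ⋆Â (prependOnes i k) Â.* 𝒑 ^Â i) S ×
    HasSum (λ i → ζ⋆Â (prependOnes i (k ∨)) Â.* 𝒑 ^Â i) T ×
    S Â.≈ Â.- T
theorem1p3 k = limit k , limit (k ∨) , hasSum k , hasSum (k ∨) , limit-duality k
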